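{- Let $L_1,L_2$ be disjoint first-order languages without function symbols, each containing at least one constant symbol, let $T_1,T_2$ be an $L_1$-theory and an $L_2$-theory, and let $T_{\mathrm{sim}}$ be the theory of simple products of $T_1$ and $T_2$. Then for every $L_{\mathrm{sim}}$-formula $\phi(\bar x)$ there exist $N$ and $L_1$-formulas $\psi_{11}(\bar x),\ldots,\psi_{1N}(\bar x)$ and $L_2$-formulas $\psi_{21}(\bar x),\ldots,\psi_{2N}(\bar x)$ such that $$T_{\mathrm{sim}}\models\forall\bar x\Big(\phi(\bar x)\leftrightarrow\bigvee_{i=1}^N\big(\widetilde{\psi}_{1i}(\bar x)\wedge\widetilde{\psi}_{2i}(\bar x)\big)\Big),$$ where $\widetilde{\psi}_{ki}$ denotes the standard conversion of $\psi_{ki}$.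
   Context: Language of simple product $L_{\mathrm{sim}}$: for each pair $(c_1,c_2)$ with $c_1$ a constant of $L_1$ and $c_2$ a constant of $L_2$ there is a constant symbol $C_{(c_1,c_2)}$ (and no other constants); its predicate symbols are those of $L_1$, those of $L_2$, and two binary predicates $\sim_1,\sim_2$. $T_\times$ is the theory stating: $\sim_1,\sim_2$ are equivalence relations; $\forall x\forall y((x\sim_1y)\wedge(x\sim_2y)\to x=y)$; $\forall x\forall y\exists z((x\sim_1z)\wedge(y\sim_2z))$. For tuples, $\bar x\sim_k\bar y$ means $\bigwedge_i x_i\sim_k y_i$. Standard conversion: for an $L_k$-formula $\phi$, $\widetilde\phi$ is the $L_{\mathrm{sim}}$-formula defined by induction: first rewrite atomic formulas $R(\bar t)$ in which constants occur as $\exists\bar y(R(\bar y)\wedge\bigwedge_i t_i=y_i)$; an equality $x=y$ of variables becomes $x\sim_k y$; an equality between a variable $x$ and a constant $c$ of $L_k$ becomes $x\sim_k C$, where $C$ is $C_{(c,d)}$ (if $k=1$) or $C_{(d,c)}$ (if $k=2$) for an arbitrary fixed constant $d$ of the other language; an equality of two constants of $L_k$ is converted similarly; $R(\bar x)$ with $R\in L_k$ stays $R(\bar x)$; the conversion commutes with Boolean connectives and existential quantification. $T_{\mathrm{sim}}$ consists of $T_\times$, all $\widetilde\sigma$ for $\sigma\in T_1\cup T_2$, and for each $k$ and each predicate $R$ of $L_k$ the sentence $\forall\bar x\forall\bar y((\bar x\sim_k\bar y)\to(R(\bar x)\leftrightarrow R(\bar y)))$.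
   Formalization: The axioms C_(c,d) ∼₁ C_(c,d') and C_(c,d) ∼₂ C_(c',d) are added to T_sim; without them the claim fails, e.g. for T_1, T_2 empty, L_1 with one constant c, L_2 with constants d, e, no predicates, and φ the sentence C_(c,d) ∼₁ C_(c,e). -}

module Defs where

open import Data.Empty.Polymorphic using (⊥)
open import Data.Fin.Base using (Fin; zero; suc; _↑ˡ_; _↑ʳ_)
open import Data.Nat.Base using (ℕ; zero; suc; _+_)
open import Data.Product.Base using (_×_; _,_; Σ-syntax)
open import Data.Sum.Base using (_⊎_)
open import Data.Vec.Base using (Vec; []; _∷_; lookup; map; tabulate)
open import Data.Vec.Relation.Unary.Any using (any?)
open import Level using (Level) renaming (suc to lsuc)
open import Relation.Binary.PropositionalEquality using (_≡_)
open import Relation.Nullary using (¬_; Dec; yes; no)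
import Data.Vec.Functional as Functional

private
  variable
    ℓ : Level
    m n : ℕ

-- Languages without function symbols. `Predicate k` is the set of k-ary
-- predicate symbols.

record Language (ℓ : Level) : Set (lsuc ℓ) where
  field
    Const     : Set ℓ
    Predicate : ℕ → Set ℓ

open Language public

private
  variable
    L : Language ℓ

data Term (L : Language ℓ) (n : ℕ) : Set ℓ where
  var : Fin n → Term L n
  con : Const L → Term L n

infix  9 _≐_
infixr 8 ¬′_
infixr 7 _∧′_
infixr 6 _∨′_
infixr 5 _⇒′_
infix  4 _⇔′_

-- Formulas with free variables among n variables (de Bruijn indices: in the
-- body of a quantifier, index zero is the bound variable).

data Formula (L : Language ℓ) (n : ℕ) : Set ℓ where
  rel            : ∀ {k} → Predicate L k → Vec (Term L n) k → Formula L n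
  _≐_            : Term L n → Term L n → Formula L n
  ⊥′             : Formula L n
  ¬′_            : Formula L n → Formula L n
  _∧′_ _∨′_ _⇒′_ : Formula L n → Formula L n → Formula L n
  ∃′_            : Formula L (suc n) → Formula L n

⊤′ : Formula L n
⊤′ = ¬′ ⊥′

_⇔′_ : Formula L n → Formula L n → Formula L n
φ ⇔′ ψ = (φ ⇒′ ψ) ∧′ (ψ ⇒′ φ)

∀′_ : Formula L (suc n) → Formula L n
∀′ φ = ¬′ (∃′ (¬′ φ))

⋀ ⋁ : (Fin m → Formula L n) → Formula L n
⋀ φ = Functional.foldr _∧′_ ⊤′ φ
⋁ φ = Functional.foldr _∨′_ ⊥′ φ

-- Quantifies the first m variables.
∃* : ∀ m → Formula L (m + n) → Formula L n
∃* zero    φ = φ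
∃* (suc m) φ = ∃* m (∃′ φ)

-- Universal closure.
∀* : Formula L n → Formula L 0
∀* {n = zero}  φ = φ
∀* {n = suc n} φ = ∀* (∀′ φ)

Sentence : Language ℓ → Set ℓ
Sentence L = Formula L 0

Theory : Language ℓ → Set (lsuc ℓ)
Theory {ℓ} L = Sentence L → Set ℓ

-- Non-emptiness of the carrier is not a field: structures are only considered
-- for languages that have a constant symbol.

record Structure {ℓ} (L : Language ℓ) : Set (lsuc ℓ) where
  field
    Carrier : Set ℓ
    ⟦_⟧ᶜ    : Const L → Carrier
    ⟦_⟧ᴾ    : ∀ {k} → Predicate L k → Vec Carrier k → Set ℓ

module _ {L : Language ℓ} (M : Structure L) where
  open Structure M

  eval : Vec Carrier n → Term L n → Carrier
  eval ρ (var x) = lookup ρ x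
  eval ρ (con c) = ⟦ c ⟧ᶜ

  Sat : Vec Carrier n → Formula L n → Set ℓ
  Sat ρ (rel R ts) = ⟦ R ⟧ᴾ (map (eval ρ) ts)
  Sat ρ (s ≐ t)    = eval ρ s ≡ eval ρ t
  Sat ρ ⊥′         = ⊥
  Sat ρ (¬′ φ)     = ¬ Sat ρ φ
  Sat ρ (φ ∧′ ψ)   = Sat ρ φ × Sat ρ ψ
  Sat ρ (φ ∨′ ψ)   = Sat ρ φ ⊎ Sat ρ ψ
  Sat ρ (φ ⇒′ ψ)   = Sat ρ φ → Sat ρ ψ
  Sat ρ (∃′ φ)     = Σ[ a ∈ Carrier ] Sat (a ∷ ρ) φ

  IsModel : Theory L → Set ℓ
  IsModel T = ∀ σ → T σ → Sat [] σ

infix 3 _⊨_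

_⊨_ : {L : Language ℓ} → Theory L → Sentence L → Set (lsuc ℓ)
_⊨_ {L = L} T σ = (M : Structure L) → IsModel M T → Sat M [] σ

-- The two languages are distinct parameters and their symbols are tagged in
-- the language of the simple product, so they are disjoint by construction.

data SimPredicate (L₁ L₂ : Language ℓ) : ℕ → Set ℓ where
  pred₁ : ∀ {k} → Predicate L₁ k → SimPredicate L₁ L₂ k
  pred₂ : ∀ {k} → Predicate L₂ k → SimPredicate L₁ L₂ k
  ∼₁ ∼₂ : SimPredicate L₁ L₂ 2

Lsim : Language ℓ → Language ℓ → Language ℓ
Lsim L₁ L₂ = record
  { Const     = Const L₁ × Const L₂
  ; Predicate = SimPredicate L₁ L₂
  }

data IsConstant {L : Language ℓ} {n} : Term L n → Set ℓ where
  con : ∀ c → IsConstant (con c)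

isConstant? : (t : Term L n) → Dec (IsConstant t)
isConstant? (var x) = no λ ()
isConstant? (con c) = yes (con c)

shift : ∀ m → Term L n → Term L (m + n)
shift m (var x) = var (m ↑ʳ x)
shift m (con c) = con c

-- Standard conversion of L-formulas to K-formulas, where `inject` embeds the
-- predicates of L, `sim` replaces equality and `C` replaces the constants.

module Conversion
  {L K : Language ℓ}
  (inject : ∀ {k} → Predicate L k → Predicate K k)
  (sim : Predicate K 2)
  (C : Const L → Const K)
  where

  convertTerm : Term L n → Term K n
  convertTerm (var x) = var x
  convertTerm (con c) = con (C c)

  convertEq : Term L n → Term L n → Formula K n
  convertEq s t = rel sim (convertTerm s ∷ convertTerm t ∷ [])

  -- If a constant occurs among t̄, then R(t̄) is first rewritten as
  -- ∃ȳ (R(ȳ) ∧ ⋀ᵢ tᵢ = yᵢ), the equalities in which are then converted.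
  convertRel : ∀ {k} → Predicate L k → Vec (Term L n) k → Formula K n
  convertRel {n = n} {k = k} R ts with any? isConstant? ts
  ... | no  _ = rel (inject R) (map convertTerm ts)
  ... | yes _ = ∃* k
          (rel (inject R) (tabulate λ i → var (i ↑ˡ n))
            ∧′ ⋀ λ i → convertEq (shift k (lookup ts i)) (var (i ↑ˡ n)))

  convert : Formula L n → Formula K n
  convert (rel R ts) = convertRel R ts
  convert (s ≐ t)    = convertEq s t
  convert ⊥′         = ⊥′
  convert (¬′ φ)     = ¬′ convert φ
  convert (φ ∧′ ψ)   = convert φ ∧′ convert ψ
  convert (φ ∨′ ψ)   = convert φ ∨′ convert ψ
  convert (φ ⇒′ ψ)   = convert φ ⇒′ convert ψ
  convert (∃′ φ)     = ∃′ convert φ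

module _ {L₁ L₂ : Language ℓ} where

  infix 9 _∼₁′_ _∼₂′_

  _∼₁′_ _∼₂′_ : Term (Lsim L₁ L₂) n → Term (Lsim L₁ L₂) n → Formula (Lsim L₁ L₂) n
  s ∼₁′ t = rel ∼₁ (s ∷ t ∷ [])
  s ∼₂′ t = rel ∼₂ (s ∷ t ∷ [])

  -- The fixed constant of the other language is an argument.
  convert₁ : Const L₂ → Formula L₁ n → Formula (Lsim L₁ L₂) n
  convert₁ d₂ = Conversion.convert pred₁ ∼₁ (λ c → (c , d₂))

  convert₂ : Const L₁ → Formula L₂ n → Formula (Lsim L₁ L₂) n
  convert₂ d₁ = Conversion.convert pred₂ ∼₂ (λ c → (d₁ , c))

module _ {L : Language ℓ} where

  private
    x y z : ∀ {n} → Term L (3 + n)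
    x = var (suc (suc zero))
    y = var (suc zero)
    z = var zero

  reflexive symmetric transitive : Predicate L 2 → Sentence L
  reflexive  S = ∀′ rel S (var zero ∷ var zero ∷ [])
  symmetric  S = ∀′ ∀′ (rel S (var (suc zero) ∷ var zero ∷ [])
                          ⇒′ rel S (var zero ∷ var (suc zero) ∷ []))
  transitive S = ∀′ ∀′ ∀′ (rel S (x ∷ y ∷ []) ∧′ rel S (y ∷ z ∷ [])
                             ⇒′ rel S (x ∷ z ∷ []))

  -- ∀x̄ ∀ȳ (x̄ S ȳ → (R(x̄) ↔ R(ȳ)))
  congruent : Predicate L 2 → ∀ {k} → Predicate L k → Sentence L
  congruent S {k} R = ∀* {n = k + k}
    ((⋀ λ i → rel S (var (i ↑ˡ k) ∷ var (k ↑ʳ i) ∷ []))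
      ⇒′ (rel R (tabulate λ i → var (i ↑ˡ k))
            ⇔′ rel R (tabulate λ i → var (k ↑ʳ i))))

module _ {L₁ L₂ : Language ℓ} where

  data T× : Theory (Lsim L₁ L₂) where
    refl₁    : T× (reflexive ∼₁)
    sym₁     : T× (symmetric ∼₁)
    trans₁   : T× (transitive ∼₁)
    refl₂    : T× (reflexive ∼₂)
    sym₂     : T× (symmetric ∼₂)
    trans₂   : T× (transitive ∼₂)
    separate : T× (∀′ ∀′ (var (suc zero) ∼₁′ var zero ∧′ var (suc zero) ∼₂′ var zero
                            ⇒′ var (suc zero) ≐ var zero))
    combine  : T× (∀′ ∀′ ∃′ (var (suc (suc zero)) ∼₁′ var zero
                               ∧′ var (suc zero) ∼₂′ var zero))

  data Tsim (d₁ : Const L₁) (d₂ : Const L₂) (T₁ : Theory L₁) (T₂ : Theory L₂) :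
            Theory (Lsim L₁ L₂) where
    product : ∀ {σ} → T× σ → Tsim d₁ d₂ T₁ T₂ σ
    axiom₁  : ∀ {σ} → T₁ σ → Tsim d₁ d₂ T₁ T₂ (convert₁ d₂ σ)
    axiom₂  : ∀ {σ} → T₂ σ → Tsim d₁ d₂ T₁ T₂ (convert₂ d₁ σ)
    cong₁   : ∀ {k} (R : Predicate L₁ k) → Tsim d₁ d₂ T₁ T₂ (congruent ∼₁ (pred₁ R))
    cong₂   : ∀ {k} (R : Predicate L₂ k) → Tsim d₁ d₂ T₁ T₂ (congruent ∼₂ (pred₂ R))

  -- C₍c,d₎ stands for the pair (c , d): its ∼₁-class depends only on c and its
  -- ∼₂-class only on d. This is what makes the choice of the fixed constant in
  -- the standard conversion immaterial. It does not follow from Tsim: without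
  -- it, C₍c,d₎ ∼₁ C₍c,d′₎ need not be equivalent to a combination of standard
  -- conversions, e.g. when T₁ and T₂ are empty.
  data PairConstants : Theory (Lsim L₁ L₂) where
    pair₁ : ∀ c d d′ → PairConstants (con (c , d) ∼₁′ con (c , d′))
    pair₂ : ∀ c c′ d → PairConstants (con (c , d) ∼₂′ con (c′ , d))

{-# OPTIONS --safe #-}
module Submission where

-- Every formula is, in all models of the theory, a disjunction of pairs
-- (ψ₁ , ψ₂) standing for ψ̃₁ ∧ ψ̃₂. Such disjunctions are closed under Boolean
-- operations by distributivity. For ∃ one uses that ψ̃ₖ is invariant under ∼ₖ:
-- witnesses a of ψ̃₁ and b of ψ̃₂ can both be replaced by an element c with
-- a ∼₁ c and b ∼₂ c, so ∃ distributes over ψ̃₁ ∧ ψ̃₂.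

open import Defs
open import Axiom.DoubleNegationElimination using (em⇒dne)
open import Axiom.ExcludedMiddle using (ExcludedMiddle)
open import Data.Fin.Base using (Fin; zero; suc; _↑ˡ_; _↑ʳ_)
open import Data.List.Base as List using (List; []; _∷_; [_]; _++_; cartesianProductWith)
open import Data.List.Membership.Propositional using (find; lose)
open import Data.List.Membership.Propositional.Properties using (∈-lookup)
open import Data.List.Relation.Unary.Any as Any using (Any; here; there)
open import Data.List.Relation.Unary.Any.Properties using (++↔; map↔; cartesianProductWith⁺; cartesianProductWith⁻;
  lookup-index)
open import Data.Nat.Base using (ℕ; zero; suc; _+_)
open import Data.Product.Base using (_×_; _,_; proj₁; proj₂; Σ-syntax; ∃-syntax)
open import Data.Product.Function.Dependent.Propositional using () renaming (cong to Σ-cong)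
open import Data.Product.Function.NonDependent.Propositional using (_×-⇔_)
open import Data.Sum.Base using (_⊎_; inj₁; inj₂)
open import Data.Sum.Function.Propositional using (_⊎-⇔_)
open import Data.Vec.Base as Vec using (Vec; []; _∷_; lookup; map; tabulate)
open import Data.Vec.Properties using (lookup-map; lookup-++ˡ; lookup-++ʳ; map-∘; tabulate-∘;
  tabulate-cong; tabulate∘lookup)
open import Data.Vec.Relation.Unary.Any using (any?)
open import Function.Base using (_∘_)
open import Function.Bundles using (_⇔_; mk⇔; Equivalence)
open import Function.Construct.Composition using (_⇔-∘_)
open import Function.Construct.Identity using (⇔-id; ↔-id)
open import Function.Construct.Symmetry using (⇔-sym)
open import Function.Properties.Inverse using (↔⇒⇔)
open import Function.Related.Propositional using (equivalence)
open import Function.Related.TypeIsomorphisms using (→-cong-⇔; ¬-cong-⇔)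
open import Level using (Level)
open import Relation.Binary.Core using (Rel)
open import Relation.Binary.PropositionalEquality using (_≡_; refl; sym; trans; cong; subst; subst₂)
open import Relation.Binary.Structures using (IsEquivalence)
open import Relation.Nullary using (¬_; yes; no; contradiction)
open import Relation.Unary using (_∪_)

open Equivalence using (to; from)
open Structure

private
  variable
    ℓ : Level
    m n k : ℕ
    L K L₁ L₂ : Language ℓ

-- Classical principles and indexing of list disjunctions.

-- Since `∀′` abbreviates not-exists-not, instantiating a universal axiom in a model is a classical
-- step.
¬∃¬⇒∀ : ExcludedMiddle ℓ → {A : Set ℓ} {P : A → Set ℓ} → ¬ (∃[ a ] ¬ P a) → ∀ a → P a
¬∃¬⇒∀ em ¬∃¬ a = em⇒dne em (λ ¬p → ¬∃¬ (a , ¬p))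

→⇔¬⊎ : ExcludedMiddle ℓ → {A B : Set ℓ} → (A → B) ⇔ (¬ A ⊎ B)
→⇔¬⊎ em {A} = mk⇔ forth (λ { (inj₁ ¬a) a → contradiction a ¬a ; (inj₂ b) _ → b })
  where
  forth : (A → _) → _
  forth f with em {A}
  ... | yes a = inj₂ (f a)
  ... | no ¬a = inj₁ ¬a

-- Links the list disjunctions used throughout with the `Fin`-indexed disjunction `⋁` of the
-- theorem.
Any⇔∃lookup : {A : Set ℓ} {P : A → Set ℓ} {xs : List A} → Any P xs ⇔ (∃[ i ] P (List.lookup xs i))
Any⇔∃lookup = mk⇔ (λ p → Any.index p , lookup-index p) (λ (i , p) → lose (∈-lookup i) p)

-- Satisfaction of the derived connectives

module _ {L : Language ℓ} (M : Structure L) where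

  Sat-⋀ : (ρ : Vec (Carrier M) n) (φ : Fin m → Formula L n) →
          Sat M ρ (⋀ φ) ⇔ (∀ i → Sat M ρ (φ i))
  Sat-⋀ {m = zero}  ρ φ = mk⇔ (λ _ ()) (λ _ ())
  Sat-⋀ {m = suc m} ρ φ = mk⇔
    (λ { (p , _) zero → p ; (_ , ps) (suc i) → to (Sat-⋀ ρ (φ ∘ suc)) ps i })
    (λ ps → ps zero , from (Sat-⋀ ρ (φ ∘ suc)) (ps ∘ suc))

  Sat-⋁ : (ρ : Vec (Carrier M) n) (φ : Fin m → Formula L n) →
          Sat M ρ (⋁ φ) ⇔ (∃[ i ] Sat M ρ (φ i))
  Sat-⋁ {m = zero}  ρ φ = mk⇔ (λ ()) (λ ())
  Sat-⋁ {m = suc m} ρ φ = mk⇔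
    (λ { (inj₁ p) → zero , p ; (inj₂ ps) → let i , p = to (Sat-⋁ ρ (φ ∘ suc)) ps in suc i , p })
    (λ { (zero , p) → inj₁ p ; (suc i , p) → inj₂ (from (Sat-⋁ ρ (φ ∘ suc)) (i , p)) })

  Sat-∃* : (ρ : Vec (Carrier M) n) (φ : Formula L (m + n)) →
           Sat M ρ (∃* m φ) ⇔ (Σ[ as ∈ Vec (Carrier M) m ] Sat M (as Vec.++ ρ) φ)
  Sat-∃* {m = zero}  ρ φ = mk⇔ ([] ,_) (λ { ([] , p) → p })
  Sat-∃* {m = suc m} ρ φ = mk⇔
    -- The innermost quantifier binds index zero, so the witness obtained last becomes the head of
    -- the vector.
    (λ p → let as , a , q = to (Sat-∃* ρ (∃′ φ)) p in a ∷ as , q)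
    (λ { (a ∷ as , q) → from (Sat-∃* ρ (∃′ φ)) (as , a , q) })

  Sat-∀* : ExcludedMiddle ℓ → (φ : Formula L n) → Sat M [] (∀* φ) ⇔ (∀ ρ → Sat M ρ φ)
  Sat-∀* {n = zero}  em φ = mk⇔ (λ { p [] → p }) (λ p → p [])
  Sat-∀* {n = suc n} em φ = mk⇔
    (λ { p (a ∷ ρ) → ¬∃¬⇒∀ em (to (Sat-∀* em (∀′ φ)) p ρ) a })
    (λ p → from (Sat-∀* em (∀′ φ)) (λ { ρ (a , ¬q) → ¬q (p (a ∷ ρ)) }))

-- Serves the blocks of variables in `congruent` and `convertRel`, each of which selects one half of
-- a concatenated assignment.
map-eval-variables : (M : Structure L) (ρ : Vec (Carrier M) n) (as : Vec (Carrier M) k)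
                     (x : Fin k → Fin n) → (∀ i → lookup ρ (x i) ≡ lookup as i) →
                     map (eval M ρ) (tabulate (λ i → var (x i))) ≡ as
map-eval-variables M ρ as x x≡as =
  trans (sym (tabulate-∘ (eval M ρ) (λ i → var (x i))))
    (trans (tabulate-cong x≡as) (tabulate∘lookup as))

eval-shift : (M : Structure L) (as : Vec (Carrier M) m) (ρ : Vec (Carrier M) n) (t : Term L n) →
             eval M (as Vec.++ ρ) (shift m t) ≡ eval M ρ t
eval-shift M as ρ (var x) = lookup-++ʳ as ρ x
eval-shift M as ρ (con c) = refl

-- The equivalence and congruence axioms, read inside a model.

Interpreted : (M : Structure L) → Predicate L 2 → Rel (Carrier M) _
Interpreted M S a b = ⟦_⟧ᴾ M S (a ∷ b ∷ [])

module _ (em : ExcludedMiddle ℓ) {L : Language ℓ} (M : Structure L) (S : Predicate L 2) where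

  interpreted-isEquivalence :
    Sat M [] (reflexive S) → Sat M [] (symmetric S) → Sat M [] (transitive S) →
    IsEquivalence (Interpreted M S)
  interpreted-isEquivalence r s t = record
    { refl  = λ {a} → ¬∃¬⇒∀ em r a
    ; sym   = λ {a} {b} → ¬∃¬⇒∀ em (¬∃¬⇒∀ em s a) b
    ; trans = λ {a} {b} {c} p q →
        ¬∃¬⇒∀ em (¬∃¬⇒∀ em (¬∃¬⇒∀ em t a) b) c (p , q)
    }

  -- The closed axiom is instantiated at the concatenation of `as` and `bs`. Only one implication is
  -- extracted; symmetry of the relation gives the converse in `congruence-⇔`.
  interpreted-congruent : (R : Predicate L k) → Sat M [] (congruent S R) →
    (as bs : Vec (Carrier M) k) → (∀ i → Interpreted M S (lookup as i) (lookup bs i)) →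
    ⟦_⟧ᴾ M R as → ⟦_⟧ᴾ M R bs
  interpreted-congruent {k = k} R c as bs as∼bs p =
    subst (⟦_⟧ᴾ M R) ys≡bs
      (proj₁ (to (Sat-∀* M em _) c ρ
        (from (Sat-⋀ M ρ (λ i → rel S (var (i ↑ˡ k) ∷ var (k ↑ʳ i) ∷ []))) (λ i →
          subst₂ (Interpreted M S) (sym (lookup-++ˡ as bs i)) (sym (lookup-++ʳ as bs i)) (as∼bs i))))
        (subst (⟦_⟧ᴾ M R) (sym xs≡as) p))
    where
    ρ = as Vec.++ bs
    xs≡as = map-eval-variables M ρ as (_↑ˡ k) (lookup-++ˡ as bs)
    ys≡bs = map-eval-variables M ρ bs (k ↑ʳ_) (lookup-++ʳ as bs)

-- Standard conversions

-- With a projection for `f`, this reads a term of the product language in one factor.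
mapConst : (Const K → Const L) → Term K n → Term L n
mapConst f (var x) = var x
mapConst f (con c) = con (f c)

-- Abstracts from the index of the factor: both conversions are instances, and all that is required
-- of the model is that `sim` is an equivalence relation respected by the predicates coming from
-- `L`.
module ConversionProperties
  {L K : Language ℓ}
  (inject : ∀ {k} → Predicate L k → Predicate K k)
  (sim : Predicate K 2)
  (C : Const L → Const K)
  (M : Structure K)
  (isEquivalence : IsEquivalence (Interpreted M sim))
  (congruence : ∀ {k} (R : Predicate L k) (as bs : Vec (Carrier M) k) →
    (∀ i → Interpreted M sim (lookup as i) (lookup bs i)) →
    ⟦_⟧ᴾ M (inject R) as → ⟦_⟧ᴾ M (inject R) bs)
  where

  open Conversion {L = L} {K = K} inject sim C
  module ∼ = IsEquivalence isEquivalence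

  private
    infix 4 _∼_ _≈_

    _∼_ : Rel (Carrier M) ℓ
    _∼_ = Interpreted M sim

    _≈_ : Rel (Vec (Carrier M) k) ℓ
    as ≈ bs = ∀ i → lookup as i ∼ lookup bs i

  congruence-⇔ : (R : Predicate L k) {as bs : Vec (Carrier M) k} → as ≈ bs →
                 ⟦_⟧ᴾ M (inject R) as ⇔ ⟦_⟧ᴾ M (inject R) bs
  congruence-⇔ R as≈bs = mk⇔ (congruence R _ _ as≈bs) (congruence R _ _ (∼.sym ∘ as≈bs))

  ∼-cong-⇔ : ∀ {a a′ b b′} → a ∼ a′ → b ∼ b′ → (a ∼ b) ⇔ (a′ ∼ b′)
  ∼-cong-⇔ p q = mk⇔
    (λ r → ∼.trans (∼.sym p) (∼.trans r q))
    (λ r → ∼.trans p (∼.trans r (∼.sym q)))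

  convertTerm-shift : (t : Term L n) → convertTerm (shift m t) ≡ shift m (convertTerm t)
  convertTerm-shift (var x) = refl
  convertTerm-shift (con c) = refl

  -- In the rewritten form the quantified tuple is tied to the values of the terms only up to `∼`,
  -- so congruence of `R` carries the relation over to these values. Conversely, the values
  -- themselves are witnesses, by reflexivity.
  Sat-convertRel : (R : Predicate L k) (ts : Vec (Term L n) k) (ρ : Vec (Carrier M) n) →
    Sat M ρ (convertRel R ts) ⇔ Sat M ρ (rel (inject R) (map convertTerm ts))
  Sat-convertRel {k = k} {n = n} R ts ρ with any? isConstant? ts
  ... | no  _ = ⇔-id _
  ... | yes _ = mk⇔ forth back
    where
    values : Vec (Carrier M) k
    values = map (eval M ρ) (map convertTerm ts)

    lookup-values : ∀ i → lookup values i ≡ eval M ρ (convertTerm (lookup ts i))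
    lookup-values i =
      trans (lookup-map i (eval M ρ) (map convertTerm ts))
        (cong (eval M ρ) (lookup-map i convertTerm ts))

    equations : Fin k → Formula K (k + n)
    equations i = convertEq (shift k (lookup ts i)) (var (i ↑ˡ n))

    body : Formula K (k + n)
    body = rel (inject R) (tabulate λ i → var (i ↑ˡ n)) ∧′ ⋀ equations

    variables≡ : (as : Vec (Carrier M) k) →
                 map (eval M (as Vec.++ ρ)) (tabulate λ i → var (i ↑ˡ n)) ≡ as
    variables≡ as = map-eval-variables M (as Vec.++ ρ) as (_↑ˡ n) (lookup-++ˡ as ρ)

    shifted≡ : (as : Vec (Carrier M) k) → ∀ i →
               eval M (as Vec.++ ρ) (convertTerm (shift k (lookup ts i))) ≡ lookup values i
    shifted≡ as i =
      trans (cong (eval M (as Vec.++ ρ)) (convertTerm-shift (lookup ts i)))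
        (trans (eval-shift M as ρ (convertTerm (lookup ts i))) (sym (lookup-values i)))

    forth : Sat M ρ (∃* k body) → ⟦_⟧ᴾ M (inject R) values
    forth p with to (Sat-∃* M ρ body) p
    ... | as , r , eqs = congruence R as values
      (λ i → ∼.sym (subst₂ _∼_ (shifted≡ as i) (lookup-++ˡ as ρ i)
        (to (Sat-⋀ M (as Vec.++ ρ) equations) eqs i)))
      (subst (⟦_⟧ᴾ M (inject R)) (variables≡ as) r)

    back : ⟦_⟧ᴾ M (inject R) values → Sat M ρ (∃* k body)
    back r = from (Sat-∃* M ρ body)
      ( values
      , subst (⟦_⟧ᴾ M (inject R)) (sym (variables≡ values)) r
      , from (Sat-⋀ M (values Vec.++ ρ) equations) (λ i →
          subst₂ _∼_ (sym (shifted≡ values i)) (sym (lookup-++ˡ values ρ i)) ∼.refl))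

  eval-cong : {ρ ρ′ : Vec (Carrier M) n} → ρ ≈ ρ′ → (t : Term K n) → eval M ρ t ∼ eval M ρ′ t
  eval-cong ρ≈ρ′ (var x) = ρ≈ρ′ x
  eval-cong ρ≈ρ′ (con c) = ∼.refl

  map-≈ : {A : Set ℓ} {f g : A → Carrier M} → (∀ x → f x ∼ g x) → (xs : Vec A k) → map f xs ≈ map g xs
  map-≈ {f = f} {g = g} f∼g xs i =
    subst₂ _∼_ (sym (lookup-map i f xs)) (sym (lookup-map i g xs)) (f∼g (lookup xs i))

  -- Genuine equality never occurs in a conversion: every atom is built from `sim` or an injected
  -- predicate, and these respect `∼`. Under a quantifier the same witness is kept on both sides.
  Sat-convert-cong : {ρ ρ′ : Vec (Carrier M) n} → ρ ≈ ρ′ → (φ : Formula L n) →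
                     Sat M ρ (convert φ) ⇔ Sat M ρ′ (convert φ)
  Sat-convert-cong {ρ = ρ} {ρ′} ρ≈ρ′ (rel R ts) =
    ⇔-sym (Sat-convertRel R ts ρ′)
      ⇔-∘ (congruence-⇔ R (map-≈ (eval-cong ρ≈ρ′) (map convertTerm ts))
      ⇔-∘ Sat-convertRel R ts ρ)
  Sat-convert-cong ρ≈ρ′ (s ≐ t)  =
    ∼-cong-⇔ (eval-cong ρ≈ρ′ (convertTerm s)) (eval-cong ρ≈ρ′ (convertTerm t))
  Sat-convert-cong ρ≈ρ′ ⊥′       = ⇔-id _
  Sat-convert-cong ρ≈ρ′ (¬′ φ)   = ¬-cong-⇔ (Sat-convert-cong ρ≈ρ′ φ)
  Sat-convert-cong ρ≈ρ′ (φ ∧′ ψ) = Sat-convert-cong ρ≈ρ′ φ ×-⇔ Sat-convert-cong ρ≈ρ′ ψ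
  Sat-convert-cong ρ≈ρ′ (φ ∨′ ψ) = Sat-convert-cong ρ≈ρ′ φ ⊎-⇔ Sat-convert-cong ρ≈ρ′ ψ
  Sat-convert-cong ρ≈ρ′ (φ ⇒′ ψ) = →-cong-⇔ (Sat-convert-cong ρ≈ρ′ φ) (Sat-convert-cong ρ≈ρ′ ψ)
  Sat-convert-cong ρ≈ρ′ (∃′ φ)   = Σ-cong {k = equivalence} (↔-id _) λ {a} →
    Sat-convert-cong (λ { zero → ∼.refl ; (suc i) → ρ≈ρ′ i }) φ

  -- Lets the witness of an existential be exchanged for an equivalent one while the remaining
  -- assignment stays fixed.
  Sat-convert-head : ∀ {a b} {ρ : Vec (Carrier M) n} → a ∼ b → (φ : Formula L (suc n)) →
                     Sat M (a ∷ ρ) (convert φ) → Sat M (b ∷ ρ) (convert φ)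
  Sat-convert-head a∼b φ = to (Sat-convert-cong (λ { zero → a∼b ; (suc i) → ∼.refl }) φ)

  -- A constant is projected to `L` and returns through `C`, possibly as a different constant;
  -- `proj-∼` says that its class is unchanged.
  module _ (proj : Const K → Const L) (proj-∼ : ∀ c → ⟦_⟧ᶜ M c ∼ ⟦_⟧ᶜ M (C (proj c))) where

    eval-mapConst : (ρ : Vec (Carrier M) n) (t : Term K n) →
                    eval M ρ t ∼ eval M ρ (convertTerm (mapConst proj t))
    eval-mapConst ρ (var x) = ∼.refl
    eval-mapConst ρ (con c) = proj-∼ c

    Sat-rel : (R : Predicate L k) (ts : Vec (Term K n) k) (ρ : Vec (Carrier M) n) →
              Sat M ρ (rel (inject R) ts) ⇔ Sat M ρ (convert (rel R (map (mapConst proj) ts)))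
    Sat-rel R ts ρ = ⇔-sym (Sat-convertRel R (map (mapConst proj) ts) ρ) ⇔-∘ congruence-⇔ R
      -- Map fusion splits the composite into the separate passes that appear in the converted
      -- formula.
      (subst (map (eval M ρ) ts ≈_)
        (trans (map-∘ (eval M ρ) (convertTerm ∘ mapConst proj) ts)
          (cong (map (eval M ρ)) (map-∘ convertTerm (mapConst proj) ts)))
        (map-≈ (eval-mapConst ρ) ts))

    Sat-sim : (s t : Term K n) (ρ : Vec (Carrier M) n) →
              Sat M ρ (rel sim (s ∷ t ∷ [])) ⇔ Sat M ρ (convert (mapConst proj s ≐ mapConst proj t))
    Sat-sim s t ρ = ∼-cong-⇔ (eval-mapConst ρ s) (eval-mapConst ρ t)

-- Disjunctions of pairs

module _ {L₁ L₂ : Language ℓ} where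

  Pair : ℕ → Set ℓ
  Pair n = Formula L₁ n × Formula L₂ n

  infixr 7 _∧ₚ_

  _∧ₚ_ : Pair n → Pair n → Pair n
  (φ₁ , φ₂) ∧ₚ (ψ₁ , ψ₂) = φ₁ ∧′ ψ₁ , φ₂ ∧′ ψ₂

  ∃ₚ : Pair (suc n) → Pair n
  ∃ₚ (φ₁ , φ₂) = ∃′ φ₁ , ∃′ φ₂

  conjunction : List (Pair n) → List (Pair n) → List (Pair n)
  conjunction = cartesianProductWith _∧ₚ_

  -- De Morgan: a pair fails when one of its halves fails, which is a disjunction of two pairs
  -- padded with `⊤′`; the results for all pairs are then conjoined by distributivity.
  negation : List (Pair n) → List (Pair n)
  negation []             = [ ⊤′ , ⊤′ ]
  negation ((φ , ψ) ∷ ps) = conjunction ((¬′ φ , ⊤′) ∷ (⊤′ , ¬′ ψ) ∷ []) (negation ps)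

  -- Computed from the syntax alone, so the same pairs serve in all models. An atom of one factor is
  -- padded with `⊤′` in the other, and an equality becomes an equality in each factor.
  decompose : Formula (Lsim L₁ L₂) n → List (Pair n)
  decompose (rel (pred₁ R) ts)      = [ rel R (map (mapConst proj₁) ts) , ⊤′ ]
  decompose (rel (pred₂ R) ts)      = [ ⊤′ , rel R (map (mapConst proj₂) ts) ]
  decompose (rel ∼₁ (s ∷ t ∷ []))   = [ mapConst proj₁ s ≐ mapConst proj₁ t , ⊤′ ]
  decompose (rel ∼₂ (s ∷ t ∷ []))   = [ ⊤′ , mapConst proj₂ s ≐ mapConst proj₂ t ]
  decompose (s ≐ t)                 = [ mapConst proj₁ s ≐ mapConst proj₁ t
                                      , mapConst proj₂ s ≐ mapConst proj₂ t ]
  decompose ⊥′                      = []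
  decompose (¬′ φ)                  = negation (decompose φ)
  decompose (φ ∧′ ψ)                = conjunction (decompose φ) (decompose ψ)
  decompose (φ ∨′ ψ)                = decompose φ ++ decompose ψ
  decompose (φ ⇒′ ψ)                = negation (decompose φ) ++ decompose ψ
  decompose (∃′ φ)                  = List.map ∃ₚ (decompose φ)

-- Correctness of the decomposition in a fixed model.

module _ (em : ExcludedMiddle ℓ) {L₁ L₂ : Language ℓ} (d₁ : Const L₁) (d₂ : Const L₂)
  {T₁ : Theory L₁} {T₂ : Theory L₂} (M : Structure (Lsim L₁ L₂))
  (model : IsModel M (Tsim d₁ d₂ T₁ T₂ ∪ PairConstants)) where

  private
    infix 4 _∼₁ᴹ_ _∼₂ᴹ_

    _∼₁ᴹ_ _∼₂ᴹ_ : Rel (Carrier M) ℓ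
    _∼₁ᴹ_ = Interpreted M ∼₁
    _∼₂ᴹ_ = Interpreted M ∼₂

    axiom : ∀ {σ} → T× σ → Sat M [] σ
    axiom σ∈T = model _ (inj₁ (product σ∈T))

    module P₁ = ConversionProperties pred₁ ∼₁ (_, d₂) M
      (interpreted-isEquivalence em M ∼₁ (axiom refl₁) (axiom sym₁) (axiom trans₁))
      (λ R → interpreted-congruent em M ∼₁ (pred₁ R) (model _ (inj₁ (cong₁ R))))

    module P₂ = ConversionProperties pred₂ ∼₂ (d₁ ,_) M
      (interpreted-isEquivalence em M ∼₂ (axiom refl₂) (axiom sym₂) (axiom trans₂))
      (λ R → interpreted-congruent em M ∼₂ (pred₂ R) (model _ (inj₁ (cong₂ R))))

    separated : ∀ {a b} → a ∼₁ᴹ b → a ∼₂ᴹ b → a ≡ b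
    separated {a} {b} p q =
      ¬∃¬⇒∀ em (¬∃¬⇒∀ em (axiom separate) a) b (p , q)

    combined : ∀ a b → Σ[ c ∈ Carrier M ] (a ∼₁ᴹ c × b ∼₂ᴹ c)
    combined a b = ¬∃¬⇒∀ em (¬∃¬⇒∀ em (axiom combine) a) b

    -- The conversion puts `d₂` in place of the second component; `PairConstants` guarantees that
    -- this does not change the class under `∼₁`.
    pair-∼₁ : ∀ c → ⟦_⟧ᶜ M c ∼₁ᴹ ⟦_⟧ᶜ M (proj₁ c , d₂)
    pair-∼₁ (c , d) = model _ (inj₂ (pair₁ c d d₂))

    pair-∼₂ : ∀ c → ⟦_⟧ᶜ M c ∼₂ᴹ ⟦_⟧ᶜ M (d₁ , proj₂ c)
    pair-∼₂ (c , d) = model _ (inj₂ (pair₂ c d₁ d))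

  Holds : Vec (Carrier M) n → Pair {L₁ = L₁} {L₂} n → Set ℓ
  Holds ρ (φ , ψ) = Sat M ρ (convert₁ d₂ φ) × Sat M ρ (convert₂ d₁ ψ)

  Any-[_] : {ρ : Vec (Carrier M) n} (p : Pair n) → Holds ρ p ⇔ Any (Holds ρ) [ p ]
  Any-[ p ] = mk⇔ here (λ { (here h) → h ; (there ()) })

  Any-conjunction : (ρ : Vec (Carrier M) n) (ps qs : List (Pair n)) →
    (Any (Holds ρ) ps × Any (Holds ρ) qs) ⇔ Any (Holds ρ) (conjunction ps qs)
  Any-conjunction ρ ps qs = mk⇔
    (λ (hs , ks) → cartesianProductWith⁺ _∧ₚ_ (λ (h₁ , h₂) (k₁ , k₂) → (h₁ , k₁) , (h₂ , k₂)) hs ks)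
    (cartesianProductWith⁻ _∧ₚ_ (λ ((h₁ , k₁) , (h₂ , k₂)) → (h₁ , h₂) , (k₁ , k₂)) ps qs)

  Any-negation : (ρ : Vec (Carrier M) n) (ps : List (Pair n)) →
    (¬ Any (Holds ρ) ps) ⇔ Any (Holds ρ) (negation ps)
  Any-negation ρ []             = mk⇔ (λ _ → here ((λ ()) , (λ ()))) (λ _ ())
  Any-negation ρ ((φ , ψ) ∷ ps) =
    Any-conjunction ρ ((¬′ φ , ⊤′) ∷ (⊤′ , ¬′ ψ) ∷ []) (negation ps) ⇔-∘ mk⇔ forth back
    where
    forth : ¬ Any (Holds ρ) ((φ , ψ) ∷ ps) →
            Any (Holds ρ) ((¬′ φ , ⊤′) ∷ (⊤′ , ¬′ ψ) ∷ []) × Any (Holds ρ) (negation ps)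
    -- A failing conjunction does not reveal which half fails; deciding the first half selects the
    -- pair of the De Morgan disjunction.
    forth ¬p with em {Sat M ρ (convert₁ d₂ φ)}
    ... | no ¬φ = here (¬φ , λ ()) , to (Any-negation ρ ps) (¬p ∘ there)
    ... | yes φ = there (here ((λ ()) , λ ψ → ¬p (here (φ , ψ)))) , to (Any-negation ρ ps) (¬p ∘ there)

    back : Any (Holds ρ) ((¬′ φ , ⊤′) ∷ (⊤′ , ¬′ ψ) ∷ []) × Any (Holds ρ) (negation ps) →
           ¬ Any (Holds ρ) ((φ , ψ) ∷ ps)
    back (here (¬φ , _)         , _) (here (φ , _)) = ¬φ φ
    back (there (here (_ , ¬ψ)) , _) (here (_ , ψ)) = ¬ψ ψ
    back (_                     , h) (there k)      = from (Any-negation ρ ps) h k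

  Holds-∃ₚ : (ρ : Vec (Carrier M) n) (p : Pair (suc n)) →
             (Σ[ a ∈ Carrier M ] Holds (a ∷ ρ) p) ⇔ Holds ρ (∃ₚ p)
  Holds-∃ₚ ρ (φ , ψ) = mk⇔
    (λ (a , h₁ , h₂) → (a , h₁) , (a , h₂))
    (λ ((a , h₁) , (b , h₂)) →
      -- The two halves may have different witnesses; `c` agrees with `a` as far as `φ` can see and
      -- with `b` as far as `ψ` can see.
      let c , a∼c , b∼c = combined a b
      in c , P₁.Sat-convert-head a∼c φ h₁ , P₂.Sat-convert-head b∼c ψ h₂)

  Any-∃ₚ : (ρ : Vec (Carrier M) n) (ps : List (Pair (suc n))) →
           (Σ[ a ∈ Carrier M ] Any (Holds (a ∷ ρ)) ps) ⇔ Any (Holds ρ) (List.map ∃ₚ ps)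
  Any-∃ₚ ρ ps = ↔⇒⇔ map↔ ⇔-∘ mk⇔
    (λ (a , hs) → Any.map (λ {p} h → to (Holds-∃ₚ ρ p) (a , h)) hs)
    (λ hs → let p , p∈ps , h = find hs ; a , k = from (Holds-∃ₚ ρ p) h in a , lose p∈ps k)

  -- Induction on `φ`, for all assignments at once because the quantifier extends `ρ`.
  Sat-decompose : (φ : Formula (Lsim L₁ L₂) n) (ρ : Vec (Carrier M) n) →
                  Sat M ρ φ ⇔ Any (Holds ρ) (decompose φ)
  Sat-decompose (rel (pred₁ R) ts) ρ =
    Any-[ _ ] ⇔-∘ (mk⇔ (_, λ ()) proj₁ ⇔-∘ P₁.Sat-rel proj₁ pair-∼₁ R ts ρ)
  Sat-decompose (rel (pred₂ R) ts) ρ =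
    Any-[ _ ] ⇔-∘ (mk⇔ ((λ ()) ,_) proj₂ ⇔-∘ P₂.Sat-rel proj₂ pair-∼₂ R ts ρ)
  Sat-decompose (rel ∼₁ (s ∷ t ∷ [])) ρ =
    Any-[ _ ] ⇔-∘ (mk⇔ (_, λ ()) proj₁ ⇔-∘ P₁.Sat-sim proj₁ pair-∼₁ s t ρ)
  Sat-decompose (rel ∼₂ (s ∷ t ∷ [])) ρ =
    Any-[ _ ] ⇔-∘ (mk⇔ ((λ ()) ,_) proj₂ ⇔-∘ P₂.Sat-sim proj₂ pair-∼₂ s t ρ)
  Sat-decompose (s ≐ t) ρ =
    -- Equality is the intersection of the two equivalence relations: reflexivity gives one
    -- inclusion, `separate` the other.
    Any-[ _ ] ⇔-∘ ((P₁.Sat-sim proj₁ pair-∼₁ s t ρ ×-⇔ P₂.Sat-sim proj₂ pair-∼₂ s t ρ) ⇔-∘ mk⇔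
      (λ s≡t → P₁.∼.reflexive s≡t , P₂.∼.reflexive s≡t)
      (λ (s∼₁t , s∼₂t) → separated s∼₁t s∼₂t))
  Sat-decompose ⊥′ ρ = mk⇔ (λ ()) (λ ())
  Sat-decompose (¬′ φ) ρ = Any-negation ρ (decompose φ) ⇔-∘ ¬-cong-⇔ (Sat-decompose φ ρ)
  Sat-decompose (φ ∧′ ψ) ρ =
    Any-conjunction ρ (decompose φ) (decompose ψ) ⇔-∘ (Sat-decompose φ ρ ×-⇔ Sat-decompose ψ ρ)
  Sat-decompose (φ ∨′ ψ) ρ = ↔⇒⇔ ++↔ ⇔-∘ (Sat-decompose φ ρ ⊎-⇔ Sat-decompose ψ ρ)
  -- An implication is read classically as a disjunction with the negated premise.
  Sat-decompose (φ ⇒′ ψ) ρ = ↔⇒⇔ ++↔ ⇔-∘ ((Any-negation ρ (decompose φ) ⊎-⇔ ⇔-id _) ⇔-∘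
    (→⇔¬⊎ em ⇔-∘ →-cong-⇔ (Sat-decompose φ ρ) (Sat-decompose ψ ρ)))
  Sat-decompose (∃′ φ) ρ = Any-∃ₚ ρ (decompose φ) ⇔-∘
    Σ-cong {k = equivalence} (↔-id _) λ {a} → Sat-decompose φ (a ∷ ρ)

theorem2p9 : ∀ {ℓ} → ExcludedMiddle ℓ →
    (L₁ L₂ : Language ℓ) (d₁ : Const L₁) (d₂ : Const L₂)
    (T₁ : Theory L₁) (T₂ : Theory L₂)
    (n : ℕ) (φ : Formula (Lsim L₁ L₂) n) →
    ∃[ N ] Σ[ ψ₁ ∈ (Fin N → Formula L₁ n) ] Σ[ ψ₂ ∈ (Fin N → Formula L₂ n) ]
    (Tsim d₁ d₂ T₁ T₂ ∪ PairConstants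
    ⊨ ∀* (φ ⇔′ ⋁ (λ i → convert₁ d₂ (ψ₁ i) ∧′ convert₂ d₁ (ψ₂ i))))
theorem2p9 em L₁ L₂ d₁ d₂ T₁ T₂ n φ =
  -- `N` is the number of pairs, and the two families list their first and second halves.
  List.length (decompose φ) , proj₁ ∘ List.lookup (decompose φ) , proj₂ ∘ List.lookup (decompose φ) ,
  λ M model → from (Sat-∀* M em _) λ ρ →
    let φ⇔ψ = ⇔-sym (Sat-⋁ M ρ _) ⇔-∘ (Any⇔∃lookup ⇔-∘ Sat-decompose em d₁ d₂ M model φ ρ)
    in to φ⇔ψ , from φ⇔ψ
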